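{- Let $T$ be a tree on $n \ge 2$ vertices with $\ell$ leaves and $s$ support vertices. Then $$\left \lceil \frac{n-\ell-s+4}{5} \right \rceil \leq \gamma_2^2(T) \leq \left \lfloor \frac{n+3s-1}{5} \right \rfloor.$$
   Context: A leaf is a vertex of degree 1; a support vertex is a vertex adjacent to a leaf. $\gamma_2^2(T)$ is the minimum size of a set $X\subseteq V(T)$ such that every vertex not in $X$ is at distance at most $2$ from some vertex of $X$, and any two distinct vertices of $X$ are at distance at least $3$ in $T$ (equivalently, the minimum size of a maximal $2$-packing). -}

module Defs where

open import Data.Nat using (ℕ; zero; suc; _+_; _≤_; _≡ᵇ_)
open import Data.Bool using (Bool; true; false; _∧_; T)
open import Data.Fin using (Fin)
open import Data.Fin.Subset using (Subset; _∈_; ∣_∣)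
open import Data.List using (List; []; _∷_; length; filter; head; last)
open import Data.List.Base using (allFin)
open import Data.List.Relation.Unary.Unique.Propositional using (Unique)
open import Data.Maybe using (Maybe; just; nothing)
open import Data.Product using (Σ; ∃; _×_; _,_)
open import Relation.Binary.PropositionalEquality using (_≡_; _≢_)
open import Relation.Nullary using (¬_)
open import Data.Bool.Properties using (T?)
open import Data.Bool.ListAction using (any)
open import Data.Unit using (⊤)
open import Data.Empty using (⊥)

record Graph (n : ℕ) : Set where
  field
    adj   : Fin n → Fin n → Bool
    sym   : ∀ u v → adj u v ≡ adj v u
    irref : ∀ v → adj v v ≡ false
open Graph public

module _ {n : ℕ} (G : Graph n) where

  Adj : Fin n → Fin n → Set
  Adj u v = T (adj G u v)

  data Walk : Fin n → Fin n → ℕ → Set where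
    here : ∀ {u} → Walk u u 0
    step : ∀ {u w v m} → Adj u w → Walk w v m → Walk u v (suc m)

  DistLE : ℕ → Fin n → Fin n → Set
  DistLE k u v = Σ ℕ λ m → m ≤ k × Walk u v m

  Connected : Set
  Connected = ∀ u v → Σ ℕ λ m → Walk u v m

  Chain : List (Fin n) → Set
  Chain []           = ⊤
  Chain (x ∷ [])     = ⊤
  Chain (x ∷ y ∷ xs) = Adj x y × Chain (y ∷ xs)

  IsCycle : List (Fin n) → Set
  IsCycle []       = ⊥
  IsCycle (x ∷ xs) =
    3 ≤ length (x ∷ xs) × Unique (x ∷ xs) × Chain (x ∷ xs)
      × Σ (Fin n) λ y → last (x ∷ xs) ≡ just y × Adj y x

  Acyclic : Set
  Acyclic = ∀ cs → ¬ IsCycle cs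

  IsTree : Set
  IsTree = Connected × Acyclic

  degree : Fin n → ℕ
  degree v = length (filter (λ w → T? (adj G v w)) (allFin n))

  isLeaf : Fin n → Bool
  isLeaf v = degree v ≡ᵇ 1

  isSupport : Fin n → Bool
  isSupport v = any (λ w → adj G v w ∧ isLeaf w) (allFin n)

  numLeaves : ℕ
  numLeaves = length (filter (λ v → T? (isLeaf v)) (allFin n))

  numSupport : ℕ
  numSupport = length (filter (λ v → T? (isSupport v)) (allFin n))

  -- X is a maximal 2-packing in the sense of the paper: every vertex not
  -- in X is at distance ≤ 2 from some vertex of X, and distinct vertices
  -- of X are at distance ≥ 3.
  Is22Set : Subset n → Set
  Is22Set X =
    (∀ v → ¬ (v ∈ X) → Σ (Fin n) λ x → x ∈ X × DistLE 2 x v)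
    × (∀ x y → x ∈ X → y ∈ X → x ≢ y → ¬ DistLE 2 x y)

  IsGamma22 : ℕ → Set
  IsGamma22 k = (Σ (Subset n) λ X → Is22Set X × ∣ X ∣ ≡ k)
              × (∀ X → Is22Set X → k ≤ ∣ X ∣)

{-# OPTIONS --safe #-}

-- A tree is presented as a rooted tree built by hanging one child subtree after another below a
-- root, so that both bounds become inductions over ◁ with finitely many cases.
--
-- Upper bound: a partial solution in a rooted subtree interacts with the rest of the tree only
-- through the distance a from the root to the chosen set (3 meaning "at least 3") and the number m
-- of top levels that may still contain undominated vertices.  Bounds on 5|X| − n − 3s for some of
-- the pairs (a, m) form a profile, and every tree fits one of nine profiles: they are closed under
-- ◁, and any two of them, the first not a single vertex, yield a complete solution with
-- 5|X| − n − 3s ≤ −1.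
--
-- Lower bound: for a set X dominating the subtree with the help of an outside vertex, the quantity
-- 5|X| + ℓ + s − n is at least a constant depending only on the distance from the root to X, the
-- distance to the helper, and whether the root is isolated or a support vertex.
--
-- Both inductions require the root not to be a leaf; for n ≥ 3 this is achieved by rerooting.
module Submission where

open import Defs renaming (sym to adj-sym; here to stay)
open import Data.Bool using (Bool; true; false; T; _∧_; _∨_; if_then_else_)
open import Data.Bool.Properties using (T?; T-∨; T-∧; T-≡; ∧-zeroʳ; ∧-identityʳ)
open import Data.Fin using (Fin; zero; suc)
import Data.Fin.Properties as Fin
open import Data.Fin.Subset using (Subset; ∣_∣) renaming (_∈_ to _∈ₛ_)
open import Data.Fin.Subset.Properties using (anySubset?) renaming (_∈?_ to _∈ₛ?_)
open import Data.List using (List; []; _∷_; [_]; _++_; length; last; filter; tabulate; allFin)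
open import Data.List.Properties using (length-++; filter-++; length-tabulate)
open import Data.List.Membership.Propositional using (_∈_; find; lose)
import Data.List.Membership.DecPropositional as DecMembership
open import Data.List.Membership.Propositional.Properties using (∈-++⁺ˡ; ∈-++⁺ʳ; ∈-++⁻; ∈-allFin)
open import Data.List.Membership.Propositional.Properties.WithK using (unique∧set⇒bag)
open import Data.List.Relation.Binary.BagAndSetEquality using (∼bag⇒↭)
open import Data.List.Relation.Binary.Disjoint.Propositional using (Disjoint)
open import Data.List.Relation.Binary.Permutation.Propositional using (_↭_; ↭-refl; ↭-sym; ↭-trans; ↭-swap; ↭⇒↭ₛ)
open import Data.List.Relation.Binary.Permutation.Propositional.Properties using (++⁺ˡ; ++⁺ʳ; ++-comm; shift; ∈-resp-↭; ↭-length; filter-↭)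
import Data.List.Relation.Binary.Permutation.Setoid.Properties as Permutation
open import Data.List.Relation.Binary.Subset.Propositional using (_⊆_)
open import Data.List.Relation.Unary.All as All using (All; []; _∷_)
open import Data.List.Relation.Unary.All.Properties using (++⁻ˡ; ++⁻ʳ)
open import Data.List.Relation.Unary.AllPairs using ([]; _∷_)
open import Data.List.Relation.Unary.Any as Any using (Any; here; there)
open import Data.List.Relation.Unary.Any.Properties using (any⁺)
open import Data.List.Relation.Unary.Unique.Propositional using (Unique)
open import Data.List.Relation.Unary.Unique.Propositional.Properties using (allFin⁺) renaming (++⁺ to Unique-++⁺)
open import Data.Maybe using (just)
open import Data.Nat using (ℕ; zero; suc; _+_; _*_; _∸_; _⊓_; _≤_; _<_; z≤n; s≤s; _≡ᵇ_; _≤?_; _≟_)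
open import Data.Nat.DivMod using (_/_; /-monoˡ-≤; m*n/n≡m; m<n*o⇒m/o<n)
open import Data.Nat.Properties hiding (_≟_; _≤?_)
open import Data.Nat.Tactic.RingSolver using (solve-∀)
open import Data.Product using (Σ; ∃; _×_; _,_; proj₁; proj₂)
open import Data.Sum using (_⊎_; inj₁; inj₂; [_,_]′)
open import Data.Unit using (⊤; tt)
open import Data.Vec as Vec using ([]; _∷_)
open import Data.Vec.Properties using (lookup∘tabulate; []=⇒lookup; lookup⇒[]=)
open import Function using (_∘_; id; mk⇔; Equivalence)
open import Relation.Binary.PropositionalEquality using (_≡_; _≢_; refl; sym; trans; cong; cong₂; subst; subst₂; setoid; module ≡-Reasoning)
open import Relation.Nullary using (¬_; Dec; yes; no; contradiction)
open import Relation.Nullary.Decidable using (_×-dec_; _⊎-dec_; _→-dec_; ¬?; from-yes; map′)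

-- Rooted trees, positions and the tree metric

infix  8 ●_
infixl 7 _◁_

-- t ◁ u hangs u below the root of t, as one more child subtree.
data Tree (A : Set) : Set where
  ●_  : A → Tree A
  _◁_ : Tree A → Tree A → Tree A

-- Positions stand for vertices by their place in the construction, so distances and counts are
-- structural recursions that make sense even if labels repeat.
data Pos {A : Set} : Tree A → Set where
  here : ∀ {a} → Pos (● a)
  inl  : ∀ {t u} → Pos t → Pos (t ◁ u)
  inr  : ∀ {t u} → Pos u → Pos (t ◁ u)

private variable
  A : Set
  t u : Tree A

root : Tree A → A
root (● a)   = a
root (t ◁ u) = root t

top : (t : Tree A) → Pos t
top (● a)   = here
top (t ◁ u) = inl (top t)

label : {t : Tree A} → Pos t → A
label {t = ● a} here = a
label (inl p) = label p
label (inr p) = label p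

labels : Tree A → List A
labels (● a)   = [ a ]
labels (t ◁ u) = labels t ++ labels u

depth : Pos t → ℕ
depth here    = 0
depth (inl p) = depth p
depth (inr q) = suc (depth q)

-- The halves of `t ◁ u` meet only in the edge between their roots, which is the `suc` of the mixed
-- cases. Both mixed cases are written in the same order, so symmetry is definitional there.
dist : Pos t → Pos t → ℕ
dist here    here    = 0
dist (inl p) (inl q) = dist p q
dist (inl p) (inr q) = depth p + suc (depth q)
dist (inr p) (inl q) = depth q + suc (depth p)
dist (inr p) (inr q) = dist p q

label-∈ : (p : Pos t) → label p ∈ labels t
label-∈ here              = here refl
label-∈ (inl p)           = ∈-++⁺ˡ (label-∈ p)
label-∈ {t = t ◁ u} (inr p) = ∈-++⁺ʳ (labels t) (label-∈ p)

position : ∀ {a : A} t → a ∈ labels t → Σ (Pos t) λ p → label p ≡ a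
position (● a) (here refl) = here , refl
position (t ◁ u) a∈ with ∈-++⁻ (labels t) a∈
... | inj₁ a∈t = let p , eq = position t a∈t in inl p , eq
... | inj₂ a∈u = let p , eq = position u a∈u in inr p , eq

label-top : (t : Tree A) → label (top t) ≡ root t
label-top (● a)   = refl
label-top (t ◁ u) = label-top t

dist-refl : (p : Pos t) → dist p p ≡ 0
dist-refl here    = refl
dist-refl (inl p) = dist-refl p
dist-refl (inr p) = dist-refl p

dist-sym : (p q : Pos t) → dist p q ≡ dist q p
dist-sym here    here    = refl
dist-sym (inl p) (inl q) = dist-sym p q
dist-sym (inl p) (inr q) = refl
dist-sym (inr p) (inl q) = refl
dist-sym (inr p) (inr q) = dist-sym p q

dist≡0⇒≡ : (p q : Pos t) → dist p q ≡ 0 → p ≡ q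
dist≡0⇒≡ here    here    _  = refl
dist≡0⇒≡ (inl p) (inl q) eq = cong inl (dist≡0⇒≡ p q eq)
dist≡0⇒≡ (inl p) (inr q) eq = contradiction (m+n≡0⇒n≡0 (depth p) eq) λ ()
dist≡0⇒≡ (inr p) (inl q) eq = contradiction (m+n≡0⇒n≡0 (depth q) eq) λ ()
dist≡0⇒≡ (inr p) (inr q) eq = cong inr (dist≡0⇒≡ p q eq)

-- The triangle inequality with the root as third point; it handles the cases of `dist-triangle` in
-- which exactly one endpoint lies in the other half.
depth-triangle : (p q : Pos t) → depth p ≤ dist p q + depth q
depth-triangle here    here    = z≤n
depth-triangle (inl p) (inl q) = depth-triangle p q
depth-triangle (inl p) (inr q) = ≤-trans (m≤m+n _ _) (m≤m+n _ _)
depth-triangle (inr p) (inl q) = ≤-trans (m≤n+m _ (depth q)) (m≤m+n _ _)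
depth-triangle (inr p) (inr q) = ≤-trans (s≤s (depth-triangle p q)) (≤-reflexive (sym (+-suc _ _)))

dist≤depth+depth : (p q : Pos t) → dist p q ≤ depth p + depth q
dist≤depth+depth here    here    = z≤n
dist≤depth+depth (inl p) (inl q) = dist≤depth+depth p q
dist≤depth+depth (inl p) (inr q) = ≤-refl
dist≤depth+depth (inr p) (inl q) = ≤-reflexive (+-comm (depth q) _)
dist≤depth+depth (inr p) (inr q) = ≤-trans (dist≤depth+depth p q) (+-mono-≤ (n≤1+n _) (n≤1+n _))

dist-triangle : (p q r : Pos t) → dist p r ≤ dist p q + dist q r
dist-triangle here    here    here    = z≤n
dist-triangle (inl p) (inl q) (inl r) = dist-triangle p q r
dist-triangle (inl p) (inl q) (inr r) = begin
  depth p + suc (depth r)               ≤⟨ +-monoˡ-≤ _ (depth-triangle p q) ⟩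
  dist p q + depth q + suc (depth r)    ≡⟨ +-assoc (dist p q) _ _ ⟩
  dist p q + (depth q + suc (depth r))  ∎
  where open ≤-Reasoning
dist-triangle (inl p) (inr q) (inl r) = begin
  dist p r                                                ≤⟨ dist≤depth+depth p r ⟩
  depth p + depth r                                       ≤⟨ +-mono-≤ (m≤m+n (depth p) _) (m≤m+n (depth r) _) ⟩
  depth p + suc (depth q) + (depth r + suc (depth q))     ∎
  where open ≤-Reasoning
dist-triangle (inl p) (inr q) (inr r) = begin
  depth p + suc (depth r)                       ≤⟨ +-monoʳ-≤ (depth p) (s≤s (depth-triangle r q)) ⟩
  depth p + suc (dist r q + depth q)            ≡⟨ cong (λ d → depth p + suc (d + depth q)) (dist-sym r q) ⟩
  depth p + suc (dist q r + depth q)            ≡⟨ cong (λ d → depth p + suc d) (+-comm (dist q r) _) ⟩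
  depth p + suc (depth q + dist q r)            ≡⟨ +-assoc (depth p) _ _ ⟨
  depth p + suc (depth q) + dist q r            ∎
  where open ≤-Reasoning
dist-triangle (inr p) (inl q) (inl r) = begin
  depth r + suc (depth p)                       ≤⟨ +-monoˡ-≤ _ (depth-triangle r q) ⟩
  dist r q + depth q + suc (depth p)            ≡⟨ +-assoc (dist r q) _ _ ⟩
  dist r q + (depth q + suc (depth p))          ≡⟨ +-comm (dist r q) _ ⟩
  depth q + suc (depth p) + dist r q            ≡⟨ cong (depth q + suc (depth p) +_) (dist-sym r q) ⟩
  depth q + suc (depth p) + dist q r            ∎
  where open ≤-Reasoning
dist-triangle (inr p) (inl q) (inr r) = begin
  dist p r                                                ≤⟨ dist≤depth+depth p r ⟩
  depth p + depth r                                       ≤⟨ +-mono-≤ (n≤1+n _) (n≤1+n _) ⟩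
  suc (depth p) + suc (depth r)                           ≤⟨ +-mono-≤ (m≤n+m _ (depth q)) (m≤n+m _ (depth q)) ⟩
  depth q + suc (depth p) + (depth q + suc (depth r))     ∎
  where open ≤-Reasoning
dist-triangle (inr p) (inr q) (inl r) = begin
  depth r + suc (depth p)                       ≤⟨ +-monoʳ-≤ (depth r) (s≤s (depth-triangle p q)) ⟩
  depth r + suc (dist p q + depth q)            ≡⟨ cong (depth r +_) (+-suc (dist p q) _) ⟨
  depth r + (dist p q + suc (depth q))          ≡⟨ +-assoc (depth r) _ _ ⟨
  depth r + dist p q + suc (depth q)            ≡⟨ cong (_+ suc (depth q)) (+-comm (depth r) _) ⟩
  dist p q + depth r + suc (depth q)            ≡⟨ +-assoc (dist p q) _ _ ⟩
  dist p q + (depth r + suc (depth q))          ∎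
  where open ≤-Reasoning
dist-triangle (inr p) (inr q) (inr r) = dist-triangle p q r

-- Lists without repetition and distinct labels

Unique-++⁻ : ∀ (xs : List A) {ys} → Unique (xs ++ ys) → Unique xs × Unique ys × Disjoint xs ys
Unique-++⁻ [] u = [] , u , λ ()
Unique-++⁻ (x ∷ xs) (x∉ ∷ u) with Unique-++⁻ xs u
... | uxs , uys , d = ++⁻ˡ xs x∉ ∷ uxs , uys , λ where
  (here refl , v∈ys) → All.lookup (++⁻ʳ xs x∉) v∈ys refl
  (there v∈xs , v∈ys) → d (v∈xs , v∈ys)

Unique-resp-↭ : {xs ys : List A} → xs ↭ ys → Unique xs → Unique ys
Unique-resp-↭ {A} xs↭ys = Permutation.Unique-resp-↭ (setoid A) (↭⇒↭ₛ xs↭ys)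

label-injective : Unique (labels t) → (p q : Pos t) → label p ≡ label q → p ≡ q
label-injective _ here here _ = refl
label-injective {t = t ◁ u} uniq p q eq with Unique-++⁻ (labels t) uniq
label-injective {t = t ◁ u} uniq (inl p) (inl q) eq | ut , uu , d = cong inl (label-injective ut p q eq)
label-injective {t = t ◁ u} uniq (inl p) (inr q) eq | ut , uu , d = contradiction (label-∈ p , subst (_∈ labels u) (sym eq) (label-∈ q)) d
label-injective {t = t ◁ u} uniq (inr p) (inl q) eq | ut , uu , d = contradiction (label-∈ q , subst (_∈ labels u) eq (label-∈ p)) d
label-injective {t = t ◁ u} uniq (inr p) (inr q) eq | ut , uu , d = cong inr (label-injective uu p q eq)

-- Spanning trees

graft : (t : Tree A) → Pos t → A → Tree A
graft (● a)   here    b = ● a ◁ ● b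
graft (t ◁ u) (inl p) b = graft t p b ◁ u
graft (t ◁ u) (inr p) b = t ◁ graft u p b

root-graft : ∀ (t : Tree A) p b → root (graft t p b) ≡ root t
root-graft (● a)   here    b = refl
root-graft (t ◁ u) (inl p) b = root-graft t p b
root-graft (t ◁ u) (inr p) b = refl

labels-graft : ∀ (t : Tree A) p b → labels (graft t p b) ↭ b ∷ labels t
labels-graft (● a)   here    b = ↭-swap a b ↭-refl
labels-graft (t ◁ u) (inl p) b = ++⁺ʳ (labels u) (labels-graft t p b)
labels-graft (t ◁ u) (inr p) b = ↭-trans (++⁺ˡ (labels t) (labels-graft u p b)) (shift b (labels t) (labels u))

module _ {n : ℕ} (G : Graph n) where

  open DecMembership (Fin._≟_ {n}) using (_∈?_)

  EdgesIn : Tree (Fin n) → Set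
  EdgesIn (● a)   = ⊤
  EdgesIn (t ◁ u) = EdgesIn t × EdgesIn u × Adj G (root t) (root u)

  Adj-sym : ∀ {x y} → Adj G x y → Adj G y x
  Adj-sym {x} {y} = subst T (adj-sym G x y)

  graft-edges : ∀ t p {b} → Adj G (label p) b → EdgesIn t → EdgesIn (graft t p b)
  graft-edges (● a)   here    pb _              = tt , tt , pb
  graft-edges (t ◁ u) (inl p) {b} pb (et , eu , e) =
    graft-edges t p pb et , eu , subst (λ r → Adj G r (root u)) (sym (root-graft t p b)) e
  graft-edges (t ◁ u) (inr p) {b} pb (et , eu , e) =
    et , graft-edges u p pb eu , subst (Adj G (root t)) (sym (root-graft u p b)) e

  Partial : Tree (Fin n) → Set
  Partial t = EdgesIn t × Unique (labels t)

  -- The tree grows along the walk: a vertex already present changes nothing, a new one is hung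
  -- below its predecessor, so labels stay distinct.
  extend : ∀ {x y m} t → Partial t → x ∈ labels t → Walk G x y m →
           ∃ λ t′ → Partial t′ × labels t ⊆ labels t′ × y ∈ labels t′
  extend t good x∈ stay = t , good , id , x∈
  extend t good x∈ (step {w = w} xw walk) with w ∈? labels t
  ... | yes w∈ = extend t good w∈ walk
  ... | no  w∉ with position t x∈
  ...   | p , refl =
    let perm = labels-graft t p w
        t′ , good′ , sub , y∈ = extend (graft t p w)
          ( graft-edges t p xw (proj₁ good)
          , Unique-resp-↭ (↭-sym perm) (All.tabulate (λ z∈ w≡z → w∉ (subst (_∈ labels t) (sym w≡z) z∈)) ∷ proj₂ good))
          (∈-resp-↭ (↭-sym perm) (here refl)) walk
    in t′ , good′ , sub ∘ ∈-resp-↭ (↭-sym perm) ∘ there , y∈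

  exhaust : Connected G → ∀ t → Partial t → ∀ ys →
          ∃ λ t′ → Partial t′ × labels t ⊆ labels t′ × ys ⊆ labels t′
  exhaust conn t good [] = t , good , id , λ ()
  exhaust conn t good (y ∷ ys) =
    let t₁ , good₁ , sub₁ , y∈ = extend t good (subst (_∈ labels t) (label-top t) (label-∈ (top t))) (proj₂ (conn (root t) y))
        t₂ , good₂ , sub₂ , ys∈ = exhaust conn t₁ good₁ ys
    in t₂ , good₂ , sub₂ ∘ sub₁ , λ { (here refl) → sub₂ y∈ ; (there z∈) → ys∈ z∈ }

  Spans : Tree (Fin n) → Set
  Spans t = EdgesIn t × labels t ↭ allFin n

  spanning : Connected G → Fin n → ∃ Spans
  spanning conn r with exhaust conn (● r) (tt , All.[] ∷ []) (allFin n)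
  ... | t , (edges , uniq) , _ , all =
    -- Two lists without repetition that have the same elements are permutations of each other.
    t , edges , ∼bag⇒↭ (unique∧set⇒bag uniq (allFin⁺ n) (mk⇔ (λ _ → ∈-allFin _) all))

  -- Geodesics in the tree

  -- Unlike `Walk`, this records the visited vertices, so that absence of repetition can be stated
  -- and a cycle extracted.
  data Path : Fin n → Fin n → List (Fin n) → Set where
    stop : ∀ {x} → Path x x [ x ]
    _∷_  : ∀ {x y z zs} → Adj G x y → Path y z zs → Path x z (x ∷ zs)

  path-++ : ∀ {x y z w xs zs} → Path x y xs → Adj G y z → Path z w zs → Path x w (xs ++ zs)
  path-++ stop     e q = e ∷ q
  path-++ (d ∷ p)  e q = d ∷ path-++ p e q

  path⇒chain : ∀ {x y xs} → Path x y xs → Chain G xs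
  path⇒chain stop              = tt
  path⇒chain (e ∷ stop)        = e , tt
  path⇒chain (e ∷ p@(_ ∷ _))   = e , path⇒chain p

  path-last : ∀ {x y xs} → Path x y xs → last xs ≡ just y
  path-last stop            = refl
  path-last (e ∷ stop)      = refl
  path-last (e ∷ p@(_ ∷ _)) = path-last p

  path⇒walk : ∀ {x y xs m} → Path x y xs → length xs ≡ suc m → Walk G x y m
  path⇒walk stop refl = stay
  path⇒walk {m = zero}  (e ∷ stop) ()
  path⇒walk {m = zero}  (e ∷ (_ ∷ _)) ()
  path⇒walk {m = suc m} (e ∷ p) eq = step e (path⇒walk p (suc-injective eq))

  path⇒Adj : ∀ {x y xs} → Path x y xs → length xs ≡ 2 → Adj G x y
  path⇒Adj (e ∷ stop) _ = e
  path⇒Adj (_ ∷ (_ ∷ stop)) ()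
  path⇒Adj (_ ∷ (_ ∷ (_ ∷ _))) ()

  path⇒cycle : ∀ {x y xs m} → Path x y xs → Adj G y x → Unique xs → length xs ≡ 3 + m → IsCycle G xs
  path⇒cycle stop _ _ ()
  path⇒cycle p@(_ ∷ _) e up lp =
    ≤-trans (s≤s (s≤s (s≤s z≤n))) (≤-reflexive (sym lp)) , up , path⇒chain p , _ , path-last p , e

  -- The field `sub` confines the path to `t`. Paths in the two halves of `t ◁ u` are then disjoint,
  -- which preserves `uniq` under concatenation.
  record Geodesic (t : Tree (Fin n)) (x y : Fin n) (m : ℕ) : Set where
    constructor geo
    field
      {vertices} : List (Fin n)
      path       : Path x y vertices
      uniq       : Unique vertices
      len        : length vertices ≡ suc m
      sub        : vertices ⊆ labels t

  geo-++ : ∀ {t u x y z w k m} → Disjoint (labels t) (labels u) →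
           Geodesic t x y k → Adj G y z → Geodesic u z w m → Geodesic (t ◁ u) x w (k + suc m)
  geo-++ {t} d (geo {xs} p up lp sp) e (geo {zs} q uq lq sq) = geo
    (path-++ p e q)
    (Unique-++⁺ up uq λ (v∈ , v∈′) → d (sp v∈ , sq v∈′))
    (trans (length-++ xs) (cong₂ _+_ lp lq))
    ([ ∈-++⁺ˡ ∘ sp , ∈-++⁺ʳ (labels t) ∘ sq ]′ ∘ ∈-++⁻ xs)

  geo-swap : ∀ {t u x y m} → Geodesic (t ◁ u) x y m → Geodesic (u ◁ t) x y m
  geo-swap {t} {u} (geo p up lp sp) = geo p up lp (∈-resp-↭ (++-comm (labels t) (labels u)) ∘ sp)

  geo-inl : ∀ {t u x y m} → Geodesic t x y m → Geodesic (t ◁ u) x y m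
  geo-inl (geo p up lp sp) = geo p up lp (∈-++⁺ˡ ∘ sp)

  geo-inr : ∀ {t u x y m} → Geodesic u x y m → Geodesic (t ◁ u) x y m
  geo-inr {t} (geo p up lp sp) = geo p up lp (∈-++⁺ʳ (labels t) ∘ sp)

  trivial : ∀ {t} (p : Pos t) → Geodesic t (label p) (label p) 0
  trivial p = geo stop (All.[] ∷ []) refl λ { (here refl) → label-∈ p }

  from-root : ∀ {t} → EdgesIn t → Unique (labels t) → (p : Pos t) → Geodesic t (root t) (label p) (depth p)
  from-root _ _ here = trivial here
  from-root {t ◁ u} (et , eu , e) un p with Unique-++⁻ (labels t) un
  from-root {t ◁ u} (et , eu , e) un (inl p) | ut , uu , d = geo-inl (from-root et ut p)
  from-root {t ◁ u} (et , eu , e) un (inr p) | ut , uu , d =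
    geo-++ d (subst (λ r → Geodesic t r r 0) (label-top t) (trivial (top t))) e (from-root eu uu p)

  to-root : ∀ {t} → EdgesIn t → Unique (labels t) → (p : Pos t) → Geodesic t (label p) (root t) (depth p)
  to-root _ _ here = trivial here
  to-root {t ◁ u} (et , eu , e) un p with Unique-++⁻ (labels t) un
  to-root {t ◁ u} (et , eu , e) un (inl p) | ut , uu , d = geo-inl (to-root et ut p)
  to-root {t ◁ u} (et , eu , e) un (inr p) | ut , uu , d =
    subst (Geodesic (t ◁ u) (label p) (root t)) (+-comm (depth p) 1)
      (geo-swap (geo-++ (λ (v∈ , v∈′) → d (v∈′ , v∈)) (to-root eu uu p) (Adj-sym e)
        (subst (λ r → Geodesic t r r 0) (label-top t) (trivial (top t)))))

  geodesic : ∀ {t} → EdgesIn t → Unique (labels t) → (p q : Pos t) → Geodesic t (label p) (label q) (dist p q)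
  geodesic _ _ here here = trivial here
  geodesic {t ◁ u} (et , eu , e) un p q with Unique-++⁻ (labels t) un
  geodesic {t ◁ u} (et , eu , e) un (inl p) (inl q) | ut , uu , d = geo-inl (geodesic et ut p q)
  geodesic {t ◁ u} (et , eu , e) un (inl p) (inr q) | ut , uu , d =
    geo-++ d (to-root et ut p) e (from-root eu uu q)
  geodesic {t ◁ u} (et , eu , e) un (inr p) (inl q) | ut , uu , d =
    subst (Geodesic (t ◁ u) (label p) (label q))
      (trans (+-suc (depth p) _) (trans (cong suc (+-comm (depth p) _)) (sym (+-suc (depth q) _))))
      (geo-swap (geo-++ (λ (v∈ , v∈′) → d (v∈′ , v∈)) (to-root eu uu p) (Adj-sym e) (from-root et ut q)))
  geodesic {t ◁ u} (et , eu , e) un (inr p) (inr q) | ut , uu , d = geo-inr (geodesic eu uu p q)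

  -- Agreement of graph distance and tree distance

  module Presented (acyclic : Acyclic G) {t : Tree (Fin n)} (spans : Spans t) where

    edges = proj₁ spans

    uniq : Unique (labels t)
    uniq = Unique-resp-↭ (↭-sym (proj₂ spans)) (allFin⁺ n)

    pos : Fin n → Pos t
    pos v = proj₁ (position t (∈-resp-↭ (↭-sym (proj₂ spans)) (∈-allFin v)))

    label-pos : ∀ v → label (pos v) ≡ v
    label-pos v = proj₂ (position t (∈-resp-↭ (↭-sym (proj₂ spans)) (∈-allFin v)))

    pos-label : ∀ p → pos (label p) ≡ p
    pos-label p = label-injective uniq _ p (label-pos (label p))

    -- Acyclicity enters here: an edge between positions at distance 2 or more would close the
    -- geodesic between them to a cycle, and distance 0 would make it a loop.
    Adj⇒dist≡1 : (p q : Pos t) → Adj G (label p) (label q) → dist p q ≡ 1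
    Adj⇒dist≡1 p q e with dist p q in eq | geodesic edges uniq p q
    ... | 0 | _ = contradiction (subst (Adj G (label p)) (cong label (sym (dist≡0⇒≡ p q eq))) e) (subst T (irref G (label p)))
    ... | 1 | _ = refl
    ... | suc (suc m) | geo {xs} path up lp _ = contradiction (path⇒cycle path (Adj-sym e) up lp) (acyclic xs)

    dist≡1⇒Adj : (p q : Pos t) → dist p q ≡ 1 → Adj G (label p) (label q)
    dist≡1⇒Adj p q eq = let geo path _ len _ = geodesic edges uniq p q in
      path⇒Adj path (trans len (cong suc eq))

    -- Every edge of the walk moves by tree distance 1, so the triangle inequality applies along it.
    walk⇒dist : ∀ {x y m} → Walk G x y m → dist (pos x) (pos y) ≤ m
    walk⇒dist {x} stay = ≤-reflexive (dist-refl (pos x))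
    walk⇒dist {x} {y} (step {w = w} e walk) = ≤-trans (dist-triangle (pos x) (pos w) (pos y))
      (+-mono-≤ (≤-reflexive (Adj⇒dist≡1 (pos x) (pos w) (subst₂ (Adj G) (sym (label-pos x)) (sym (label-pos w)) e)))
                (walk⇒dist walk))

    DistLE⇒dist : ∀ {k x y} → DistLE G k x y → dist (pos x) (pos y) ≤ k
    DistLE⇒dist (m , m≤k , walk) = ≤-trans (walk⇒dist walk) m≤k

    dist⇒DistLE : ∀ {k} x y → dist (pos x) (pos y) ≤ k → DistLE G k x y
    dist⇒DistLE x y d≤k = let geo path _ len _ = geodesic edges uniq (pos x) (pos y) in
      _ , d≤k , subst₂ (λ a b → Walk G a b (dist (pos x) (pos y))) (label-pos x) (label-pos y) (path⇒walk path len)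

-- Counting positions

bit : Bool → ℕ
bit b = if b then 1 else 0

count : (t : Tree A) → (Pos t → Bool) → ℕ
count (● a)   P = bit (P here)
count (t ◁ u) P = count t (P ∘ inl) + count u (P ∘ inr)

size : Tree A → ℕ
size (● a)   = 1
size (t ◁ u) = size t + size u

count-cong : (t : Tree A) {P Q : Pos t → Bool} → (∀ p → P p ≡ Q p) → count t P ≡ count t Q
count-cong (● a)   P≡Q = cong bit (P≡Q here)
count-cong (t ◁ u) P≡Q = cong₂ _+_ (count-cong t (P≡Q ∘ inl)) (count-cong u (P≡Q ∘ inr))

count-mono : (t : Tree A) {P Q : Pos t → Bool} → (∀ p → T (P p) → T (Q p)) → count t P ≤ count t Q
count-mono (● a) {P} {Q} P⇒Q with P here | Q here | P⇒Q here
... | false | _     | _ = z≤n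
... | true  | true  | _ = ≤-refl
... | true  | false | f = contradiction (f tt) λ ()
count-mono (t ◁ u) P⇒Q = +-mono-≤ (count-mono t (P⇒Q ∘ inl)) (count-mono u (P⇒Q ∘ inr))

count-none : (t : Tree A) {P : Pos t → Bool} → (∀ p → ¬ T (P p)) → count t P ≡ 0
count-none (● a) {P} none with P here | none here
... | false | _ = refl
... | true  | f = contradiction tt f
count-none (t ◁ u) none = cong₂ _+_ (count-none t (none ∘ inl)) (count-none u (none ∘ inr))

-- Leaves and support vertices

-- `single` is a one-vertex tree, `supp` a tree whose root has a childless child, `plain` any other
-- tree.
data Kind : Set where
  single plain supp : Kind

single? : Kind → Bool
single? single = true
single? _      = false

fresh : Kind → ℕ
fresh supp = 0
fresh _    = 1

hang : Kind → Kind → Kind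
hang supp   _      = supp
hang single single = supp
hang plain  single = supp
hang single _      = plain
hang plain  _      = plain

-- The root becomes a new support vertex exactly when the hung subtree is one vertex and no such
-- child was there before.
newSupp : Kind → Kind → ℕ
newSupp k l = if single? l then fresh k else 0

kind : Tree A → Kind
kind (● a)   = single
kind (t ◁ u) = hang (kind t) (kind u)

single?-hang : ∀ k l → single? (hang k l) ≡ false
single?-hang single single = refl
single?-hang single plain  = refl
single?-hang single supp   = refl
single?-hang plain  single = refl
single?-hang plain  plain  = refl
single?-hang plain  supp   = refl
single?-hang supp   _      = refl

fresh-hang : ∀ k l → fresh (hang k l) ≡ (if single? l then 0 else fresh k)
fresh-hang single single = refl
fresh-hang single plain  = refl
fresh-hang single supp   = refl
fresh-hang plain  single = refl
fresh-hang plain  plain  = refl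
fresh-hang plain  supp   = refl
fresh-hang supp   single = refl
fresh-hang supp   plain  = refl
fresh-hang supp   supp   = refl

-- The root is not counted as a leaf here, whatever its degree.
#leaf #supp : Tree A → ℕ
#leaf (● a)   = 0
#leaf (t ◁ u) = #leaf t + #leaf u + bit (single? (kind u))
#supp (● a)   = 0
#supp (t ◁ u) = #supp t + #supp u + newSupp (kind t) (kind u)

top? : Pos t → Bool
top? p = depth p ≡ᵇ 0

-- `leaf?` and `support?` mark the vertices behind the numbers `#leaf` and `#supp`: the numbers suit
-- the inductions, the marks allow the comparison with the graph.
leaf? : {t : Tree A} → Pos t → Bool
leaf? here = false
leaf? (inl p) = leaf? p
leaf? {t = t ◁ u} (inr p) = single? (kind u) ∨ leaf? p

support? : {t : Tree A} → Pos t → Bool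
support? here = false
support? {t = t ◁ u} (inl p) = top? p ∧ single? (kind u) ∨ support? p
support? (inr p) = support? p

count-hung-leaf : (u : Tree A) →
  count u (λ p → single? (kind u) ∨ leaf? p) ≡ count u leaf? + bit (single? (kind u))
count-hung-leaf (● a) = refl
count-hung-leaf (v ◁ w) rewrite single?-hang (kind v) (kind w) = sym (+-identityʳ _)

count-leaf? : (t : Tree A) → count t leaf? ≡ #leaf t
count-leaf? (● a) = refl
count-leaf? (t ◁ u) = trans
  (cong₂ _+_ (count-leaf? t) (trans (count-hung-leaf u) (cong (_+ bit (single? (kind u))) (count-leaf? u))))
  (sym (+-assoc (#leaf t) _ _))

-- The root is already marked precisely for the kind `supp`, so marking it as well adds `fresh`.
count-top∨support? : (t : Tree A) → count t (λ p → top? p ∨ support? p) ≡ count t support? + fresh (kind t)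
count-top∨support? (● a) = refl
count-top∨support? (t ◁ u) rewrite fresh-hang (kind t) (kind u) with single? (kind u)
-- A leaf hung below the root has already marked the root, so `top?` adds nothing.
... | true  = trans (cong (_+ count u support?) (count-cong t λ p → absorb (top? p))) (sym (+-identityʳ _))
  where
  absorb : ∀ b {c} → b ∨ b ∧ true ∨ c ≡ b ∧ true ∨ c
  absorb true  = refl
  absorb false = refl
... | false = begin
  count t (λ p → top? p ∨ top? p ∧ false ∨ support? p) + s
    ≡⟨ cong (_+ s) (count-cong t λ p → cong (λ b → top? p ∨ b ∨ support? p) (∧-zeroʳ (top? p))) ⟩
  count t (λ p → top? p ∨ support? p) + s
    ≡⟨ cong (_+ s) (count-top∨support? t) ⟩
  count t support? + fresh (kind t) + s
    ≡⟨ +-assoc (count t support?) _ _ ⟩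
  count t support? + (fresh (kind t) + s)
    ≡⟨ cong (count t support? +_) (+-comm (fresh (kind t)) s) ⟩
  count t support? + (s + fresh (kind t))
    ≡⟨ +-assoc (count t support?) _ _ ⟨
  count t support? + s + fresh (kind t)
    ≡⟨ cong (λ c → c + s + fresh (kind t)) (count-cong t λ p → cong (_∨ support? p) (∧-zeroʳ (top? p))) ⟨
  count t (λ p → top? p ∧ false ∨ support? p) + s + fresh (kind t) ∎
  where
  open ≡-Reasoning
  s = count u support?

count-support? : (t : Tree A) → count t support? ≡ #supp t
count-support? (● a) = refl
count-support? (t ◁ u) with single? (kind u)
... | true = begin
  count t (λ p → top? p ∧ true ∨ support? p) + count u support?
    ≡⟨ cong₂ _+_ (count-cong t λ p → cong (_∨ support? p) (∧-identityʳ (top? p))) (count-support? u) ⟩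
  count t (λ p → top? p ∨ support? p) + #supp u
    ≡⟨ cong (_+ #supp u) (trans (count-top∨support? t) (cong (_+ fresh (kind t)) (count-support? t))) ⟩
  #supp t + fresh (kind t) + #supp u
    ≡⟨ swap (#supp t) _ _ ⟩
  #supp t + #supp u + fresh (kind t) ∎
  where
  open ≡-Reasoning
  swap : ∀ a b c → a + b + c ≡ a + c + b
  swap = solve-∀
... | false = begin
  count t (λ p → top? p ∧ false ∨ support? p) + count u support?
    ≡⟨ cong₂ _+_ (count-cong t λ p → cong (_∨ support? p) (∧-zeroʳ (top? p))) (count-support? u) ⟩
  count t support? + #supp u
    ≡⟨ cong (_+ #supp u) (count-support? t) ⟩
  #supp t + #supp u
    ≡⟨ +-identityʳ _ ⟨
  #supp t + #supp u + 0 ∎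
  where open ≡-Reasoning

leaf⇒depth>0 : (p : Pos t) → T (leaf? p) → 0 < depth p
leaf⇒depth>0 (inl p) l = leaf⇒depth>0 p l
leaf⇒depth>0 (inr p) l = s≤s z≤n

count-top : (t : Tree A) → count t top? ≡ 1
count-top (● a) = refl
count-top (t ◁ u) = cong₂ _+_ (count-top t) (count-none u λ _ ())

cross-none : ∀ {d} → 0 < d → ∀ e → ¬ T (d + suc e ≡ᵇ 1)
cross-none {suc d} _ e eq = contradiction (m+n≡0⇒n≡0 d (≡ᵇ⇒≡ (d + suc e) 0 eq)) λ ()

-- A marked leaf is never the root of the half in which it is already marked, so the new edge gives
-- it no neighbour. If the hung subtree is one vertex, its only neighbour is the root above.
leaf-degree : (p : Pos t) → T (leaf? p) → count t (λ q → dist p q ≡ᵇ 1) ≡ 1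
leaf-degree {t = t ◁ u} (inl p) l =
  cong₂ _+_ (leaf-degree p l) (count-none u λ q → cross-none (leaf⇒depth>0 p l) (depth q))
leaf-degree {t = t ◁ ● b} (inr here) l =
  cong (_+ 0) (trans (count-cong t λ p → cong (_≡ᵇ 1) (+-comm (depth p) 1)) (count-top t))
leaf-degree {t = t ◁ u@(v ◁ w)} (inr q) l rewrite single?-hang (kind v) (kind w) =
  cong₂ _+_
    (count-none t λ p e → cross-none (leaf⇒depth>0 q l) (depth p)
      (subst (λ d → T (d ≡ᵇ 1)) (trans (+-suc (depth p) (depth q)) (trans (cong suc (+-comm (depth p) _)) (sym (+-suc (depth q) _)))) e))
    (leaf-degree q l)

support⇒leaf : (p : Pos t) → T (support? p) → ∃ λ q → T (leaf? q) × dist p q ≡ 1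
support⇒leaf {t = t ◁ u} (inl p) s with Equivalence.to (T-∨ {top? p ∧ single? (kind u)}) s
... | inj₂ s′ = let q , l , d = support⇒leaf p s′ in inl q , l , d
support⇒leaf {t = t ◁ ● b} (inl p) s | inj₁ top =
  inr here , tt , cong (_+ 1) (≡ᵇ⇒≡ (depth p) 0 (proj₁ (Equivalence.to T-∧ top)))
support⇒leaf {t = t ◁ (v ◁ w)} (inl p) s | inj₁ top rewrite single?-hang (kind v) (kind w) =
  contradiction (proj₂ (Equivalence.to (T-∧ {top? p}) top)) λ ()
support⇒leaf {t = t ◁ u} (inr p) s = let q , l , d = support⇒leaf p s in
  inr q , Equivalence.from (T-∨ {single? (kind u)}) (inj₂ l) , d

-- The upper bound

Dominated : (Pos t → Bool) → Pos t → Set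
Dominated ξ p = ∃ λ x → T (ξ x) × dist x p ≤ 2

-- For `a ≤ 2`, `far` and `near` together make the distance from the root to the set exactly `a`.
-- For `a = 3` only `far` has content, and the set may be empty.
record Solution (t : Tree A) (a m : ℕ) (ξ : Pos t → Bool) : Set where
  constructor solution
  field
    far     : ∀ x → T (ξ x) → a ≤ depth x
    near    : a ≤ 2 → ∃ λ x → T (ξ x) × depth x ≤ a
    packing : ∀ x y → T (ξ x) → T (ξ y) → dist x y ≤ 2 → x ≡ y
    cover   : ∀ p → Dominated ξ p ⊎ depth p < m

-- An entry (a , m , w) bounds 5|X| − n − 3s by w − 5; the shift keeps w in ℕ.
Entry : Set
Entry = ℕ × ℕ × ℕ

Realised : Tree A → Entry → Set
Realised t (a , m , w) = ∃ λ ξ → Solution t a m ξ × 5 * count t ξ + 5 ≤ size t + 3 * #supp t + w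

-- Arithmetic conditions under which the union of two partial solutions is again one. In order: the
-- sets stay apart across the new edge; `c` is the distance to the union; levels left undominated in
-- either half are passed on to `l` or reached from the other half; the weights add up, one of the
-- two shifts by 5 being returned and each new support vertex paying 3.
Joins : ℕ → Entry → Entry → Entry → Set
Joins δ (a , m , w) (b , k , v) (c , l , z) =
    3 ≤ a + suc b
  × c ≤ a
  × c ≤ suc b
  × (3 ≤ c ⊎ a ≤ c ⊎ suc b ≤ c)
  × (m ≤ l ⊎ b + m ≤ 2)
  × (k ≤ 0 ⊎ suc k ≤ l ⊎ a + k ≤ 2)
  × w + v ≤ z + 5 + 3 * δ

joins? : ∀ δ p q r → Dec (Joins δ p q r)
joins? δ (a , m , w) (b , k , v) (c , l , z) =
  (3 ≤? a + suc b) ×-dec (c ≤? a) ×-dec (c ≤? suc b)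
  ×-dec (3 ≤? c ⊎-dec a ≤? c ⊎-dec suc b ≤? c)
  ×-dec (m ≤? l ⊎-dec b + m ≤? 2)
  ×-dec (k ≤? 0 ⊎-dec suc k ≤? l ⊎-dec a + k ≤? 2)
  ×-dec (w + v ≤? z + 5 + 3 * δ)

_▷_ : {t u : Tree A} → (Pos t → Bool) → (Pos u → Bool) → Pos (t ◁ u) → Bool
(ξ ▷ ζ) (inl p) = ξ p
(ξ ▷ ζ) (inr p) = ζ p

join : ∀ p q r → Joins (newSupp (kind t) (kind u)) p q r → Realised t p → Realised u q → Realised (t ◁ u) r
join {t = t} {u = u} (a , m , w) (b , k , v) (c , l , z) (3≤ , c≤a , c≤b , attained , coverₜ , coverᵤ , weights)
  (ξ , solution fₜ nₜ pₜ cₜ , wₜ) (ζ , solution fᵤ nᵤ pᵤ cᵤ , wᵤ) = ξ ▷ ζ , solution far near packing cover , weight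
  where
  far : ∀ x → T ((ξ ▷ ζ) x) → c ≤ depth x
  far (inl x) ξx = ≤-trans c≤a (fₜ x ξx)
  far (inr x) ζx = ≤-trans c≤b (s≤s (fᵤ x ζx))

  near : c ≤ 2 → ∃ λ x → T ((ξ ▷ ζ) x) × depth x ≤ c
  near c≤2 = go attained
    where
    go : 3 ≤ c ⊎ a ≤ c ⊎ suc b ≤ c → ∃ λ x → T ((ξ ▷ ζ) x) × depth x ≤ c
    go (inj₁ 3≤c)        = contradiction (≤-trans 3≤c c≤2) (<⇒≱ ≤-refl)
    go (inj₂ (inj₁ a≤c)) = let x , ξx , d = nₜ (≤-trans a≤c c≤2) in inl x , ξx , ≤-trans d a≤c
    go (inj₂ (inj₂ b<c)) = let x , ζx , d = nᵤ (≤-trans (<⇒≤ b<c) c≤2) in inr x , ζx , ≤-trans (s≤s d) b<c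

  apart : ∀ x y → T (ξ x) → T (ζ y) → ¬ depth x + suc (depth y) ≤ 2
  apart x y ξx ζy ≤2 = contradiction (≤-trans 3≤ (≤-trans (+-mono-≤ (fₜ x ξx) (s≤s (fᵤ y ζy))) ≤2)) (<⇒≱ ≤-refl)

  packing : ∀ x y → T ((ξ ▷ ζ) x) → T ((ξ ▷ ζ) y) → dist x y ≤ 2 → x ≡ y
  packing (inl x) (inl y) ξx ξy d = cong inl (pₜ x y ξx ξy d)
  packing (inl x) (inr y) ξx ζy d = contradiction d (apart x y ξx ζy)
  packing (inr x) (inl y) ζx ξy d = contradiction d (apart y x ξy ζx)
  packing (inr x) (inr y) ζx ζy d = cong inr (pᵤ x y ζx ζy d)

  cover : ∀ p → Dominated (ξ ▷ ζ) p ⊎ depth p < l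
  cover (inl p) = go (cₜ p) coverₜ
    where
    open ≤-Reasoning
    go : Dominated ξ p ⊎ depth p < m → m ≤ l ⊎ b + m ≤ 2 → Dominated (ξ ▷ ζ) (inl p) ⊎ depth p < l
    go (inj₁ (x , ξx , d)) _            = inj₁ (inl x , ξx , d)
    go (inj₂ p<m)          (inj₁ m≤l)   = inj₂ (≤-trans p<m m≤l)
    -- The depth of `p` is at most `m` - 1, so `b + m` already includes the connecting edge.
    go (inj₂ p<m)          (inj₂ b+m≤2) =
      let x , ζx , d = nᵤ (≤-trans (m≤m+n b m) b+m≤2) in inj₁ (inr x , ζx , (begin
        depth p + suc (depth x) ≡⟨ +-suc (depth p) (depth x) ⟩
        suc (depth p) + depth x ≤⟨ +-mono-≤ p<m d ⟩
        m + b                   ≡⟨ +-comm m b ⟩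
        b + m                   ≤⟨ b+m≤2 ⟩
        2                       ∎))
  cover (inr p) = go (cᵤ p) coverᵤ
    where
    go : Dominated ζ p ⊎ depth p < k → k ≤ 0 ⊎ suc k ≤ l ⊎ a + k ≤ 2 → Dominated (ξ ▷ ζ) (inr p) ⊎ suc (depth p) < l
    go (inj₁ (x , ζx , d)) _                   = inj₁ (inr x , ζx , d)
    go (inj₂ p<k)          (inj₁ k≤0)          = contradiction (≤-trans p<k k≤0) λ ()
    go (inj₂ p<k)          (inj₂ (inj₁ k<l))   = inj₂ (≤-trans (s≤s p<k) k<l)
    go (inj₂ p<k)          (inj₂ (inj₂ a+k≤2)) =
      let x , ξx , d = nₜ (≤-trans (m≤m+n a k) a+k≤2) in inj₁ (inl x , ξx , ≤-trans (+-mono-≤ d p<k) a+k≤2)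

  δ = newSupp (kind t) (kind u)

  weight : 5 * (count t ξ + count u ζ) + 5 ≤ size t + size u + 3 * (#supp t + #supp u + δ) + z
  weight = +-cancelʳ-≤ 5 _ _ (begin
    5 * (count t ξ + count u ζ) + 5 + 5                               ≡⟨ regroup (count t ξ) (count u ζ) ⟩
    (5 * count t ξ + 5) + (5 * count u ζ + 5)                         ≤⟨ +-mono-≤ wₜ wᵤ ⟩
    (size t + 3 * #supp t + w) + (size u + 3 * #supp u + v)       ≡⟨ collect (size t) (#supp t) w (size u) (#supp u) v ⟩
    size t + size u + 3 * (#supp t + #supp u) + (w + v)           ≤⟨ +-monoʳ-≤ (size t + size u + 3 * (#supp t + #supp u)) weights ⟩
    size t + size u + 3 * (#supp t + #supp u) + (z + 5 + 3 * δ)   ≡⟨ distribute (size t + size u) (#supp t + #supp u) z δ ⟩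
    size t + size u + 3 * (#supp t + #supp u + δ) + z + 5         ∎)
    where
    open ≤-Reasoning
    regroup : ∀ x y → 5 * (x + y) + 5 + 5 ≡ (5 * x + 5) + (5 * y + 5)
    regroup = solve-∀
    collect : ∀ n s w m r v → (n + 3 * s + w) + (m + 3 * r + v) ≡ n + m + 3 * (s + r) + (w + v)
    collect = solve-∀
    distribute : ∀ n s z d → n + 3 * s + (z + 5 + 3 * d) ≡ n + 3 * (s + d) + z + 5
    distribute = solve-∀

Profile : Set
Profile = Kind × List Entry

-- A tree realises all entries of its profile, each by its own set, so an entry can be picked to
-- suit the other half. The first profile is that of one vertex: chosen, it has excess 5 - 1,
-- shifted to 9; left out, -1, shifted to 4, with one level undominated.
profiles : List Profile
profiles =
    (single , (0 , 0 , 9) ∷ (3 , 1 , 4) ∷ [])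
  ∷ (plain  , (0 , 0 , 4) ∷ (1 , 0 , 4) ∷ (2 , 0 , 4) ∷ [])
  ∷ (plain  , (0 , 0 , 0) ∷ (1 , 0 , 0) ∷ (2 , 2 , 0) ∷ [])
  ∷ (plain  , (0 , 0 , 8) ∷ (1 , 0 , 3) ∷ (3 , 1 , 3) ∷ [])
  ∷ (plain  , (0 , 0 , 7) ∷ (2 , 0 , 2) ∷ (3 , 2 , 2) ∷ [])
  ∷ (plain  , (0 , 0 , 6) ∷ (3 , 1 , 1) ∷ [])
  ∷ (plain  , (0 , 0 , 5) ∷ (1 , 0 , 5) ∷ (3 , 2 , 0) ∷ [])
  ∷ (supp   , (0 , 0 , 5) ∷ (1 , 0 , 5) ∷ (3 , 2 , 0) ∷ [])
  ∷ (supp   , (0 , 0 , 0) ∷ (1 , 0 , 0) ∷ (2 , 2 , 0) ∷ [])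
  ∷ []

Reaches : Profile → Profile → Entry → Set
Reaches (k , ps) (l , qs) r = Any (λ p → Any (λ q → Joins (newSupp k l) p q r) qs) ps

reaches? : ∀ P Q r → Dec (Reaches P Q r)
reaches? (k , ps) (l , qs) r = Any.any? (λ p → Any.any? (λ q → joins? (newSupp k l) p q r) qs) ps

_≟ᵏ_ : (k l : Kind) → Dec (k ≡ l)
single ≟ᵏ single = yes refl
single ≟ᵏ plain  = no λ ()
single ≟ᵏ supp   = no λ ()
plain  ≟ᵏ single = no λ ()
plain  ≟ᵏ plain  = yes refl
plain  ≟ᵏ supp   = no λ ()
supp   ≟ᵏ single = no λ ()
supp   ≟ᵏ plain  = no λ ()
supp   ≟ᵏ supp   = yes refl

-- `m = 0` leaves nothing undominated, which forces the distance from the root to be at most 2;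
-- weight 4 encodes the bound -1.
complete : List Entry
complete = (0 , 0 , 4) ∷ (1 , 0 , 4) ∷ (2 , 0 , 4) ∷ []

abstract
  -- A finite check over all pairs of profiles, settled by evaluation; `abstract` prevents its proof
  -- from being unfolded later.
  profiles-closed : All (λ P → All (λ Q → Any (λ R →
    hang (proj₁ P) (proj₁ Q) ≡ proj₁ R × All (Reaches P Q) (proj₂ R)) profiles) profiles) profiles
  profiles-closed = from-yes (All.all? (λ P → All.all? (λ Q → Any.any? (λ R →
    (hang (proj₁ P) (proj₁ Q) ≟ᵏ proj₁ R) ×-dec All.all? (reaches? P Q) (proj₂ R)) profiles) profiles) profiles)

  -- If `P` were `single`, the root would be a leaf, and `#supp` could miss the support vertex next
  -- to it.
  profiles-complete : All (λ P → All (λ Q → proj₁ P ≢ single → Any (Reaches P Q) complete) profiles) profiles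
  profiles-complete = from-yes (All.all? (λ P → All.all? (λ Q →
    ¬? (proj₁ P ≟ᵏ single) →-dec Any.any? (reaches? P Q) complete) profiles) profiles)

Fits : Tree A → Profile → Set
Fits t (k , ps) = kind t ≡ k × All (Realised t) ps

reach : ∀ {P Q r} → Reaches P Q r → Fits t P → Fits u Q → Realised (t ◁ u) r
reach reaches (refl , realisedₜ) (refl , realisedᵤ) =
  let p , p∈ , joinsₚ = find reaches
      q , q∈ , joins  = find joinsₚ
  in join p q _ joins (All.lookup realisedₜ p∈) (All.lookup realisedᵤ q∈)

fits : (t : Tree A) → Any (Fits t) profiles
fits (● a) = here (refl , (occupied ∷ empty ∷ []))
  where
  occupied : Realised (● a) (0 , 0 , 9)
  occupied = (λ _ → true) , solution (λ _ _ → z≤n) (λ _ → here , tt , z≤n) (λ { here here _ _ _ → refl }) (λ { here → inj₁ (here , tt , z≤n) }) , ≤-refl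
  empty : Realised (● a) (3 , 1 , 4)
  empty = (λ _ → false) , solution (λ _ ()) (λ { (s≤s (s≤s ())) }) (λ _ _ ()) (λ { here → inj₂ ≤-refl }) , ≤-refl
fits (t ◁ u) =
  let P , P∈ , fitsₜ = find (fits t)
      Q , Q∈ , fitsᵤ = find (fits u)
      R , R∈ , hang≡ , reaches = find (All.lookup (All.lookup profiles-closed P∈) Q∈)
  in lose R∈ ( trans (cong₂ hang (proj₁ fitsₜ) (proj₁ fitsᵤ)) hang≡
             , All.map (λ r → reach r fitsₜ fitsᵤ) reaches)

Is22 : (t : Tree A) → (Pos t → Bool) → Set
Is22 t ξ = (∀ p → Dominated ξ p) × (∀ x y → T (ξ x) → T (ξ y) → dist x y ≤ 2 → x ≡ y)

solution⇒Is22 : ∀ {a ξ} → Solution t a 0 ξ → Is22 t ξ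
solution⇒Is22 s = (λ p → [ id , (λ ()) ]′ (Solution.cover s p)) , Solution.packing s

small-Is22 : (t u : Tree A) → kind t ≢ single →
  ∃ λ ξ → Is22 (t ◁ u) ξ × 5 * count (t ◁ u) ξ + 1 ≤ size (t ◁ u) + 3 * #supp (t ◁ u)
small-Is22 t u t≢● =
  let P , P∈ , fitsₜ = find (fits t)
      Q , Q∈ , fitsᵤ = find (fits u)
      r , r∈ , reaches = find (All.lookup (All.lookup profiles-complete P∈) Q∈ (t≢● ∘ trans (proj₁ fitsₜ)))
      ξ , s , weight = reach reaches fitsₜ fitsᵤ
      m≡0 , w≡4 = All.lookup {P = λ r → proj₁ (proj₂ r) ≡ 0 × proj₂ (proj₂ r) ≡ 4} ((refl , refl) ∷ (refl , refl) ∷ (refl , refl) ∷ []) r∈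
  in ξ , solution⇒Is22 (subst (λ m → Solution (t ◁ u) (proj₁ r) m ξ) m≡0 s)
   -- The weight 4 cancels all but 1 of the shift 5.
   , +-cancelʳ-≤ 4 _ _ (≤-trans (≤-reflexive (+-assoc (5 * count (t ◁ u) ξ) 1 4))
       (subst (λ w → 5 * count (t ◁ u) ξ + 5 ≤ size (t ◁ u) + 3 * #supp (t ◁ u) + w) w≡4 weight))

-- The lower bound

-- The distance from the root to the set, capped at 3: from there on a vertex dominates neither the
-- root nor anything beyond it.
nearest : (t : Tree A) → (Pos t → Bool) → ℕ
nearest (● a)   ξ = if ξ here then 0 else 3
nearest (t ◁ u) ξ = nearest t (ξ ∘ inl) ⊓ suc (nearest u (ξ ∘ inr))

nearest≤depth : (t : Tree A) (ξ : Pos t → Bool) → ∀ x → T (ξ x) → nearest t ξ ≤ depth x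
nearest≤depth (● a) ξ here ξx with ξ here
... | true = z≤n
nearest≤depth (t ◁ u) ξ (inl x) ξx = ≤-trans (m⊓n≤m _ _) (nearest≤depth t (ξ ∘ inl) x ξx)
nearest≤depth (t ◁ u) ξ (inr x) ξx = ≤-trans (m⊓n≤n _ _) (s≤s (nearest≤depth u (ξ ∘ inr) x ξx))

nearest≤3 : (t : Tree A) (ξ : Pos t → Bool) → nearest t ξ ≤ 3
nearest≤3 (● a) ξ with ξ here
... | true  = z≤n
... | false = ≤-refl
nearest≤3 (t ◁ u) ξ = ≤-trans (m⊓n≤m _ _) (nearest≤3 t (ξ ∘ inl))

-- Domination with the help of one vertex outside t, at distance suc i from the root of t.
Assisted : (t : Tree A) → (Pos t → Bool) → ℕ → Set
Assisted t ξ i = ∀ p → Dominated ξ p ⊎ depth p + suc i ≤ 2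

-- The old helper and the set in `u` both act on `t` through its root, so the nearer of them can
-- replace both.
assisted-inl : ∀ {ξ i} → Assisted (t ◁ u) ξ i → Assisted t (ξ ∘ inl) (i ⊓ nearest u (ξ ∘ inr))
assisted-inl {u = u} {ξ} {i} assisted p with assisted (inl p)
... | inj₁ (inl x , ξx , d) = inj₁ (x , ξx , d)
... | inj₁ (inr x , ξx , d) = inj₂ (≤-trans (+-monoʳ-≤ (depth p) (s≤s (≤-trans (m⊓n≤n i _) (nearest≤depth u (ξ ∘ inr) x ξx)))) d)
... | inj₂ ≤2               = inj₂ (≤-trans (+-monoʳ-≤ (depth p) (s≤s (m⊓n≤m i _))) ≤2)

-- From `u` the old helper is one step farther away. The cap at 2 loses nothing, since a helper at
-- distance 3 reaches no vertex, and it keeps the range of cases finite.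
assisted-inr : ∀ {ξ i} → Assisted (t ◁ u) ξ i → Assisted u (ξ ∘ inr) (suc i ⊓ nearest t (ξ ∘ inl) ⊓ 2)
assisted-inr {t = t} {ξ = ξ} {i} assisted p with assisted (inr p)
... | inj₁ (inr x , ξx , d) = inj₁ (x , ξx , d)
... | inj₁ (inl x , ξx , d) = inj₂ (begin
  depth p + suc (suc i ⊓ nearest t (ξ ∘ inl) ⊓ 2) ≤⟨ +-monoʳ-≤ (depth p) (s≤s (≤-trans (m⊓n≤m (suc i ⊓ nearest t (ξ ∘ inl)) 2) (m⊓n≤n (suc i) _))) ⟩
  depth p + suc (nearest t (ξ ∘ inl))             ≤⟨ +-monoʳ-≤ (depth p) (s≤s (nearest≤depth t (ξ ∘ inl) x ξx)) ⟩
  depth p + suc (depth x)                         ≡⟨ +-suc (depth p) _ ⟩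
  suc (depth p) + depth x                         ≡⟨ +-comm (suc (depth p)) _ ⟩
  depth x + suc (depth p)                         ≤⟨ d ⟩
  2                                               ∎)
  where open ≤-Reasoning
... | inj₂ ≤2 = inj₂ (begin
  depth p + suc (suc i ⊓ nearest t (ξ ∘ inl) ⊓ 2) ≤⟨ +-monoʳ-≤ (depth p) (s≤s (≤-trans (m⊓n≤m (suc i ⊓ nearest t (ξ ∘ inl)) 2) (m⊓n≤m (suc i) _))) ⟩
  depth p + suc (suc i)                           ≡⟨ +-suc (depth p) _ ⟩
  suc (depth p) + suc i                           ≤⟨ ≤2 ⟩
  2                                               ∎)
  where open ≤-Reasoning

-- gain k a i is one more than the lower bound on 5|X| + ℓ + s − n.  A set cannot dominate a single
-- vertex (a = 3) from distance 3 (i = 2), so that value, and the large ones derived from it, only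
-- have to be consistent with gain-hang.
gain : Kind → ℕ → ℕ → ℕ
gain single 3 0 = 0
gain single 3 1 = 0
gain single _ _ = 5
gain plain  0 _ = 5
gain plain  1 _ = 4
gain plain  2 _ = 3
gain plain  _ 0 = 1
gain plain  _ 1 = 2
gain plain  _ _ = 7
gain supp   0 _ = 6
gain supp   1 _ = 5
gain supp   2 0 = 4
gain supp   2 _ = 6
gain supp   _ 0 = 1
gain supp   _ 1 = 6
gain supp   _ _ = 11

-- The gains of the halves, each helped by the set in the other as in `assisted-inl` and
-- `assisted-inr`, plus the leaf and the support vertex created by the new edge.
gain◁ : Kind → Kind → ℕ → ℕ → ℕ → ℕ
gain◁ k l a b i = gain k a (i ⊓ b) + gain l b (suc i ⊓ a ⊓ 2) + (bit (single? l) + newSupp k l)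

allKinds? : {P : Kind → Set} → (∀ k → Dec (P k)) → Dec (∀ k → P k)
allKinds? P? = map′ (λ { (s , p , q) single → s ; (s , p , q) plain → p ; (s , p , q) supp → q })
  (λ f → f single , f plain , f supp) (P? single ×-dec P? plain ×-dec P? supp)

abstract
  -- Each `gain` is shifted by one; the summand 1 balances the two shifts on the right against the
  -- single one on the left.
  gain-hang : ∀ k l {a} → a < 4 → ∀ {b} → b < 4 → ∀ {i} → i < 3 →
              gain (hang k l) (a ⊓ suc b) i + 1 ≤ gain◁ k l a b i
  gain-hang = from-yes (allKinds? λ k → allKinds? λ l → allUpTo? (λ a → allUpTo? (λ b → allUpTo? (λ i →
    gain (hang k l) (a ⊓ suc b) i + 1 ≤? gain◁ k l a b i) 3) 4) 4)

  -- Here `i = 2` amounts to no helper, and 6 is the final 4 plus one shift per half. For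
  -- `k = single` the root would be a leaf that `#leaf` does not count.
  gain-top : ∀ k l → k ≢ single → ∀ {a} → a < 4 → ∀ {b} → b < 4 → 6 ≤ gain◁ k l a b 2
  gain-top = from-yes (allKinds? λ k → allKinds? λ l → ¬? (k ≟ᵏ single) →-dec
    allUpTo? (λ a → allUpTo? (λ b → 6 ≤? gain◁ k l a b 2) 4) 4)

mutual
  gain-bound : (t : Tree A) (ξ : Pos t → Bool) → ∀ {i} → i < 3 → Assisted t ξ i →
    size t + gain (kind t) (nearest t ξ) i ≤ 5 * count t ξ + (#leaf t + #supp t) + 1
  gain-bound (● a) ξ {i} i<3 assisted with ξ here in eq | assisted here
  ... | true  | _ = ≤-refl
  ... | false | inj₁ (here , ξx , _) = contradiction (subst T eq ξx) λ ()
  -- Only `i = 0` and `i = 1` let the helper reach the vertex, and both have gain 0.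
  ... | false | inj₂ (s≤s z≤n) = ≤-refl
  ... | false | inj₂ (s≤s (s≤s z≤n)) = ≤-refl
  gain-bound (t ◁ u) ξ {i} i<3 assisted = +-cancelʳ-≤ 1 _ _ (begin
    size t + size u + gain (hang (kind t) (kind u)) (a ⊓ suc b) i + 1
      ≡⟨ +-assoc (size t + size u) _ 1 ⟩
    size t + size u + (gain (hang (kind t) (kind u)) (a ⊓ suc b) i + 1)
      ≤⟨ +-monoʳ-≤ (size t + size u) (gain-hang (kind t) (kind u) (s≤s (nearest≤3 t _)) (s≤s (nearest≤3 u _)) i<3) ⟩
    size t + size u + gain◁ (kind t) (kind u) a b i
      ≤⟨ gain◁-bound t u ξ i<3 assisted ⟩
    5 * count (t ◁ u) ξ + (#leaf (t ◁ u) + #supp (t ◁ u)) + 2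
      ≡⟨ +-assoc (5 * count (t ◁ u) ξ + (#leaf (t ◁ u) + #supp (t ◁ u))) 1 1 ⟨
    5 * count (t ◁ u) ξ + (#leaf (t ◁ u) + #supp (t ◁ u)) + 1 + 1 ∎)
    where
    open ≤-Reasoning
    a = nearest t (ξ ∘ inl)
    b = nearest u (ξ ∘ inr)

  -- Kept separate from `gain-bound` because at the root of the whole tree the same sum is estimated
  -- by `gain-top` instead of `gain-hang`.
  gain◁-bound : (t u : Tree A) (ξ : Pos (t ◁ u) → Bool) → ∀ {i} → i < 3 → Assisted (t ◁ u) ξ i →
    size (t ◁ u) + gain◁ (kind t) (kind u) (nearest t (ξ ∘ inl)) (nearest u (ξ ∘ inr)) i
      ≤ 5 * count (t ◁ u) ξ + (#leaf (t ◁ u) + #supp (t ◁ u)) + 2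
  gain◁-bound t u ξ {i} i<3 assisted = begin
    size t + size u + (gₜ + gᵤ + (l + s))
      ≡⟨ regroup (size t) (size u) gₜ gᵤ (l + s) ⟩
    (size t + gₜ) + (size u + gᵤ) + (l + s)
      ≤⟨ +-monoˡ-≤ (l + s) (+-mono-≤
           (gain-bound t (ξ ∘ inl) (≤-<-trans (m⊓n≤m i b) i<3) (assisted-inl {t = t} assisted))
           (gain-bound u (ξ ∘ inr) (s≤s (m⊓n≤n (suc i ⊓ a) 2)) (assisted-inr {u = u} assisted))) ⟩
    (5 * cₜ + (#leaf t + #supp t) + 1) + (5 * cᵤ + (#leaf u + #supp u) + 1) + (l + s)
      ≡⟨ collect cₜ cᵤ (#leaf t) (#leaf u) (#supp t) (#supp u) l s ⟩
    5 * (cₜ + cᵤ) + (#leaf t + #leaf u + l + (#supp t + #supp u + s)) + 2 ∎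
    where
    open ≤-Reasoning
    a = nearest t (ξ ∘ inl)
    b = nearest u (ξ ∘ inr)
    gₜ = gain (kind t) a (i ⊓ b)
    gᵤ = gain (kind u) b (suc i ⊓ a ⊓ 2)
    l = bit (single? (kind u))
    s = newSupp (kind t) (kind u)
    cₜ = count t (ξ ∘ inl)
    cᵤ = count u (ξ ∘ inr)
    regroup : ∀ m n x y z → m + n + (x + y + z) ≡ (m + x) + (n + y) + z
    regroup = solve-∀
    collect : ∀ c d l₁ l₂ s₁ s₂ l s →
      (5 * c + (l₁ + s₁) + 1) + (5 * d + (l₂ + s₂) + 1) + (l + s) ≡ 5 * (c + d) + (l₁ + l₂ + l + (s₁ + s₂ + s)) + 2
    collect = solve-∀

dominating-bound : (t u : Tree A) → kind t ≢ single → (ξ : Pos (t ◁ u) → Bool) → (∀ p → Dominated ξ p) →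
  size (t ◁ u) + 4 ≤ 5 * count (t ◁ u) ξ + (#leaf (t ◁ u) + #supp (t ◁ u))
dominating-bound t u t≢● ξ dom = +-cancelʳ-≤ 2 _ _ (begin
  size (t ◁ u) + 4 + 2   ≡⟨ +-assoc (size (t ◁ u)) 4 2 ⟩
  size (t ◁ u) + 6       ≤⟨ +-monoʳ-≤ (size (t ◁ u)) (gain-top (kind t) (kind u) t≢● (s≤s (nearest≤3 t _)) (s≤s (nearest≤3 u _))) ⟩
  size (t ◁ u) + gain◁ (kind t) (kind u) (nearest t (ξ ∘ inl)) (nearest u (ξ ∘ inr)) 2
                         ≤⟨ gain◁-bound t u ξ ≤-refl (inj₁ ∘ dom) ⟩
  5 * count (t ◁ u) ξ + (#leaf (t ◁ u) + #supp (t ◁ u)) + 2 ∎)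
  where open ≤-Reasoning

-- Transfer from rooted trees to the graph

compound : (v w : Tree A) → kind (v ◁ w) ≢ single
compound v w eq = contradiction (trans (sym (cong single? eq)) (single?-hang (kind v) (kind w))) λ ()

length-labels : (t : Tree A) → length (labels t) ≡ size t
length-labels (● a)   = refl
length-labels (t ◁ u) = trans (length-++ (labels t)) (cong₂ _+_ (length-labels t) (length-labels u))

count-labels : (t : Tree A) (P : A → Bool) → count t (P ∘ label) ≡ length (filter (T? ∘ P) (labels t))
count-labels (● a) P with P a
... | true  = refl
... | false = refl
count-labels (t ◁ u) P = begin
  count t (P ∘ label) + count u (P ∘ label)
    ≡⟨ cong₂ _+_ (count-labels t P) (count-labels u P) ⟩
  length (filter (T? ∘ P) (labels t)) + length (filter (T? ∘ P) (labels u))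
    ≡⟨ length-++ (filter (T? ∘ P) (labels t)) ⟨
  length (filter (T? ∘ P) (labels t) ++ filter (T? ∘ P) (labels u))
    ≡⟨ cong length (filter-++ (T? ∘ P) (labels t) (labels u)) ⟨
  length (filter (T? ∘ P) (labels t ++ labels u)) ∎
  where open ≡-Reasoning

-- Stated for an arbitrary `f` so that the induction can pass to `f ∘ suc`.
∣∣≡length-filter : ∀ {m n} (X : Subset m) (f : Fin m → Fin n) (P : Fin n → Bool) → (∀ i → P (f i) ≡ Vec.lookup X i) →
  ∣ X ∣ ≡ length (filter (T? ∘ P) (tabulate f))
∣∣≡length-filter [] f P eq = refl
∣∣≡length-filter (true  ∷ X) f P eq rewrite eq zero = cong suc (∣∣≡length-filter X (f ∘ suc) P (eq ∘ suc))
∣∣≡length-filter (false ∷ X) f P eq rewrite eq zero = ∣∣≡length-filter X (f ∘ suc) P (eq ∘ suc)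

T-extensional : ∀ {a b} → (T a → T b) → (T b → T a) → a ≡ b
T-extensional {true}  {true}  _ _ = refl
T-extensional {true}  {false} f _ = contradiction (f tt) λ ()
T-extensional {false} {true}  _ g = contradiction (g tt) λ ()
T-extensional {false} {false} _ _ = refl

least : {P : ℕ → Set} → (∀ k → Dec (P k)) → ∀ k → P k → ∃ λ m → P m × m ≤ k × (∀ j → P j → m ≤ j)
least P? k Pk with P? 0
least P? k       Pk | yes P0 = 0 , P0 , z≤n , λ _ _ → z≤n
least P? zero    Pk | no ¬P0 = contradiction Pk ¬P0
least P? (suc k) Pk | no ¬P0 with least (P? ∘ suc) k Pk
... | m , Pm , m≤k , min = suc m , Pm , s≤s m≤k , λ where
  zero    P0 → contradiction P0 ¬P0
  (suc j) Pj → s≤s (min j Pj)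

module _ {n : ℕ} (G : Graph n) where

  module Transfer (acyclic : Acyclic G) {t : Tree (Fin n)} (spans : Spans G t) where

    open Presented G acyclic spans

    size≡n : size t ≡ n
    size≡n = trans (sym (length-labels t)) (trans (↭-length (proj₂ spans)) (length-tabulate id))

    count-vertices : (P : Fin n → Bool) → count t (P ∘ label) ≡ length (filter (T? ∘ P) (allFin n))
    count-vertices P = trans (count-labels t P) (↭-length (filter-↭ (T? ∘ P) (proj₂ spans)))

    degree≡count : ∀ p → degree G (label p) ≡ count t (λ q → dist p q ≡ᵇ 1)
    degree≡count p = trans (sym (count-vertices (adj G (label p)))) (count-cong t λ q → T-extensional
      (≡⇒≡ᵇ _ 1 ∘ Adj⇒dist≡1 p q) (dist≡1⇒Adj p q ∘ ≡ᵇ⇒≡ _ 1))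

    leaf?⇒isLeaf : (p : Pos t) → T (leaf? p) → T (isLeaf G (label p))
    leaf?⇒isLeaf p l = ≡⇒≡ᵇ _ 1 (trans (degree≡count p) (leaf-degree p l))

    support?⇒isSupport : (p : Pos t) → T (support? p) → T (isSupport G (label p))
    support?⇒isSupport p s = let q , l , d = support⇒leaf p s in
      any⁺ _ (lose (∈-allFin (label q)) (Equivalence.from T-∧ (dist≡1⇒Adj p q d , leaf?⇒isLeaf q l)))

    -- An inequality serves the purpose because leaf and support counts occur only on the larger
    -- side of both bounds.
    #leaf≤numLeaves : #leaf t ≤ numLeaves G
    #leaf≤numLeaves = begin
      #leaf t                     ≡⟨ count-leaf? t ⟨
      count t leaf?               ≤⟨ count-mono t leaf?⇒isLeaf ⟩
      count t (isLeaf G ∘ label)  ≡⟨ count-vertices (isLeaf G) ⟩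
      numLeaves G                 ∎
      where open ≤-Reasoning

    #supp≤numSupport : #supp t ≤ numSupport G
    #supp≤numSupport = begin
      #supp t                        ≡⟨ count-support? t ⟨
      count t support?               ≤⟨ count-mono t support?⇒isSupport ⟩
      count t (isSupport G ∘ label)  ≡⟨ count-vertices (isSupport G) ⟩
      numSupport G                   ∎
      where open ≤-Reasoning

    module _ {X : Subset n} {ξ : Pos t → Bool} (X≗ξ : ∀ p → Vec.lookup X (label p) ≡ ξ p) where

      ∈⇒T : ∀ {v} → v ∈ₛ X → T (ξ (pos v))
      ∈⇒T {v} v∈ = Equivalence.from T-≡ (begin
        ξ (pos v)                     ≡⟨ X≗ξ (pos v) ⟨
        Vec.lookup X (label (pos v))  ≡⟨ cong (Vec.lookup X) (label-pos v) ⟩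
        Vec.lookup X v                ≡⟨ []=⇒lookup v∈ ⟩
        true                          ∎)
        where open ≡-Reasoning

      T⇒∈ : ∀ {p} → T (ξ p) → label p ∈ₛ X
      T⇒∈ {p} ξp = lookup⇒[]= (label p) X (trans (X≗ξ p) (Equivalence.to T-≡ ξp))

      ∣X∣≡count : ∣ X ∣ ≡ count t ξ
      ∣X∣≡count = trans (∣∣≡length-filter X id (Vec.lookup X) (λ _ → refl))
        (trans (sym (count-vertices (Vec.lookup X))) (count-cong t X≗ξ))

      Is22Set⇒dominated : Is22Set G X → ∀ p → Dominated ξ p
      Is22Set⇒dominated (dom , _) p with label p ∈ₛ? X
      ... | yes p∈ = p , subst (T ∘ ξ) (pos-label p) (∈⇒T p∈) , ≤-trans (≤-reflexive (dist-refl p)) z≤n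
      ... | no  p∉ = let x , x∈ , d = dom (label p) p∉ in
        pos x , ∈⇒T x∈ , subst (λ q → dist (pos x) q ≤ 2) (pos-label p) (DistLE⇒dist d)

      Is22⇒Is22Set : Is22 t ξ → Is22Set G X
      Is22⇒Is22Set (dom , pack) =
          (λ v _ → let x , ξx , d = dom (pos v) in label x , T⇒∈ ξx , dist⇒DistLE (label x) v (subst (λ q → dist q (pos v) ≤ 2) (sym (pos-label x)) d))
        , (λ x y x∈ y∈ x≢y d → x≢y (begin
            x              ≡⟨ label-pos x ⟨
            label (pos x)  ≡⟨ cong label (pack (pos x) (pos y) (∈⇒T x∈) (∈⇒T y∈) (DistLE⇒dist d)) ⟩
            label (pos y)  ≡⟨ label-pos y ⟩
            y              ∎))
        where open ≡-Reasoning

    -- Computable tree distances make `Is22Set` decidable, and with it the search for the minimum in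
    -- `gamma`.
    distLE? : ∀ k x y → Dec (DistLE G k x y)
    distLE? k x y = map′ (dist⇒DistLE x y) DistLE⇒dist (dist (pos x) (pos y) ≤? k)

    is22Set? : ∀ X → Dec (Is22Set G X)
    is22Set? X =
      Fin.all? (λ v → ¬? (v ∈ₛ? X) →-dec Fin.any? (λ x → (x ∈ₛ? X) ×-dec distLE? 2 x v))
      ×-dec Fin.all? (λ x → Fin.all? (λ y → (x ∈ₛ? X) →-dec (y ∈ₛ? X) →-dec ¬? (x Fin.≟ y) →-dec ¬? (distLE? 2 x y)))

    gamma : ∀ X → Is22Set G X → ∃ λ k → IsGamma22 G k × k ≤ ∣ X ∣
    gamma X X22 with least (λ k → anySubset? λ Y → is22Set? Y ×-dec (∣ Y ∣ ≟ k)) ∣ X ∣ (X , X22 , refl)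
    ... | k , attained , k≤ , min = k , (attained , λ Y Y22 → min ∣ Y ∣ (Y , Y22 , refl)) , k≤

    subset : (Pos t → Bool) → Subset n
    subset ξ = Vec.tabulate (ξ ∘ pos)

    subset≗ : ∀ ξ p → Vec.lookup (subset ξ) (label p) ≡ ξ p
    subset≗ ξ p = trans (lookup∘tabulate (ξ ∘ pos) (label p)) (cong ξ (pos-label p))

  -- If the root is a leaf, exchanging the two halves moves the root to its only neighbour, which
  -- has another neighbour since `3 ≤ n`.
  reroot : ∃ (Spans G) → 3 ≤ n → ∃ λ t → ∃ λ u → kind t ≢ single × Spans G (t ◁ u)
  reroot (t , spans) 3≤n with trans (sym (length-labels t)) (trans (↭-length (proj₂ spans)) (length-tabulate {n = n} id))
  reroot (● a , _) 3≤n | refl = contradiction 3≤n λ { (s≤s ()) }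
  reroot (● a ◁ ● b , _) 3≤n | refl = contradiction 3≤n λ { (s≤s (s≤s ())) }
  reroot (● a ◁ t@(v ◁ w) , (_ , edges , e) , perm) 3≤n | _ =
    t , ● a , compound v w , (edges , tt , Adj-sym G e) , ↭-trans (++-comm (labels t) (labels (● a))) perm
  reroot (v ◁ w ◁ u , spans) 3≤n | _ = v ◁ w , u , compound v w , spans

  n≥3-bounds : 3 ≤ n → IsTree G → Fin n →
    ∃ λ k → IsGamma22 G k × n + 4 ≤ 5 * k + (numLeaves G + numSupport G) × 5 * k + 1 ≤ n + 3 * numSupport G
  n≥3-bounds 3≤n (conn , acyclic) r with reroot (spanning G conn r) 3≤n
  ... | t , u , t≢● , spans = k , isγ , lower , upper
    where
    open Transfer acyclic spans
    open ≤-Reasoning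
    small = small-Is22 t u t≢●
    ξ = proj₁ small
    found = gamma (subset ξ) (Is22⇒Is22Set (subset≗ ξ) (proj₁ (proj₂ small)))
    k = proj₁ found
    isγ = proj₁ (proj₂ found)

    lower : n + 4 ≤ 5 * k + (numLeaves G + numSupport G)
    -- The lower bound is applied to a set attaining the minimum, not to the constructed one.
    lower = let (Y , Y22 , ∣Y∣≡k) , _ = isγ in begin
      n + 4
        ≡⟨ cong (_+ 4) size≡n ⟨
      size (t ◁ u) + 4
        ≤⟨ dominating-bound t u t≢● (Vec.lookup Y ∘ label) (Is22Set⇒dominated (λ _ → refl) Y22) ⟩
      5 * count (t ◁ u) (Vec.lookup Y ∘ label) + (#leaf (t ◁ u) + #supp (t ◁ u))
        ≡⟨ cong (λ c → 5 * c + _) (trans (sym (∣X∣≡count {X = Y} (λ _ → refl))) ∣Y∣≡k) ⟩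
      5 * k + (#leaf (t ◁ u) + #supp (t ◁ u))
        ≤⟨ +-monoʳ-≤ (5 * k) (+-mono-≤ #leaf≤numLeaves #supp≤numSupport) ⟩
      5 * k + (numLeaves G + numSupport G) ∎

    upper : 5 * k + 1 ≤ n + 3 * numSupport G
    upper = begin
      5 * k + 1                           ≤⟨ +-monoˡ-≤ 1 (*-monoʳ-≤ 5 (proj₂ (proj₂ found))) ⟩
      5 * ∣ subset ξ ∣ + 1                ≡⟨ cong (λ c → 5 * c + 1) (∣X∣≡count {X = subset ξ} (subset≗ ξ)) ⟩
      5 * count (t ◁ u) ξ + 1             ≤⟨ proj₂ (proj₂ small) ⟩
      size (t ◁ u) + 3 * #supp (t ◁ u)    ≤⟨ +-mono-≤ (≤-reflexive size≡n) (*-monoʳ-≤ 3 #supp≤numSupport) ⟩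
      n + 3 * numSupport G                ∎

-- For n = 2 the root of any presentation is a leaf, so this case is separate.
n≡2-bounds : (G : Graph 2) → Connected G →
  IsGamma22 G 1 × 2 + 4 ≤ 5 * 1 + (numLeaves G + numSupport G) × 5 * 1 + 1 ≤ 2 + 3 * numSupport G
n≡2-bounds G conn = isγ , subst (λ s → 6 ≤ 5 + (numLeaves G + s)) (sym support≡2) (+-monoʳ-≤ 5 (m≤n⇒m≤o+n (numLeaves G) (s≤s z≤n)))
  , subst (λ s → 6 ≤ 2 + 3 * s) (sym support≡2) (m≤m+n 6 2)
  where
  edge : Adj G zero (suc zero)
  edge with conn zero (suc zero)
  ... | _ , step {w = zero} loop _ = contradiction loop (subst T (irref G zero))
  ... | _ , step {w = suc zero} e _ = e

  edge≡ : adj G zero (suc zero) ≡ true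
  edge≡ = Equivalence.to T-≡ edge

  edge≡′ : adj G (suc zero) zero ≡ true
  edge≡′ = trans (adj-sym G (suc zero) zero) edge≡

  degree₀ : degree G zero ≡ 1
  degree₀ rewrite irref G zero | edge≡ = refl

  degree₁ : degree G (suc zero) ≡ 1
  degree₁ rewrite edge≡′ | irref G (suc zero) = refl

  support₀ : isSupport G zero ≡ true
  support₀ rewrite irref G zero | edge≡ | degree₁ = refl

  support₁ : isSupport G (suc zero) ≡ true
  support₁ rewrite edge≡′ | degree₀ = refl

  support≡2 : numSupport G ≡ 2
  support≡2 rewrite support₀ | support₁ = refl

  isγ : IsGamma22 G 1
  isγ = (true ∷ false ∷ [] , (dominated , packed) , refl) , minimal
    where
    dominated : ∀ v → ¬ (v ∈ₛ true ∷ false ∷ []) → ∃ λ x → x ∈ₛ true ∷ false ∷ [] × DistLE G 2 x v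
    dominated zero       0∉ = contradiction Vec.here 0∉
    dominated (suc zero) _  = zero , Vec.here , 1 , s≤s z≤n , step edge stay
    packed : ∀ x y → x ∈ₛ true ∷ false ∷ [] → y ∈ₛ true ∷ false ∷ [] → x ≢ y → ¬ DistLE G 2 x y
    packed zero       zero       _ _ 0≢0 _ = 0≢0 refl
    packed (suc zero) _          (Vec.there ()) _ _ _
    packed zero       (suc zero) _ (Vec.there ()) _ _
    minimal : ∀ X → Is22Set G X → 1 ≤ ∣ X ∣
    minimal (true ∷ _)          _ = s≤s z≤n
    minimal (false ∷ true ∷ []) _ = s≤s z≤n
    minimal (false ∷ false ∷ []) (dom , _) with dom zero (λ ())
    ... | suc zero , Vec.there () , _

-- Rounding

-- Adding 4 before dividing by 5 turns the floor into a ceiling; this 4 is separate from the one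
-- that `x = n + 4` contains in the application.
ceiling-bound : ∀ {x k c} → x ≤ 5 * k + c → (x ∸ c + 4) / 5 ≤ k
ceiling-bound {x} {k} {c} x≤ = ≤-pred (m<n*o⇒m/o<n (begin-strict
  x ∸ c + 4        ≤⟨ +-monoˡ-≤ 4 (m≤n+o⇒m∸n≤o x c (≤-trans x≤ (≤-reflexive (+-comm (5 * k) c)))) ⟩
  5 * k + 4        <⟨ +-monoʳ-< (5 * k) ≤-refl ⟩
  5 * k + 5        ≡⟨ +-comm (5 * k) 5 ⟩
  5 + 5 * k        ≡⟨ cong (5 +_) (*-comm 5 k) ⟩
  suc k * 5        ∎))
  where open ≤-Reasoning

floor-bound : ∀ {k x} → 5 * k + 1 ≤ x → k ≤ (x ∸ 1) / 5
floor-bound {k} {x} ≤x = begin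
  k                 ≡⟨ m*n/n≡m k 5 ⟨
  k * 5 / 5         ≤⟨ /-monoˡ-≤ 5 (≤-trans (≤-reflexive (trans (*-comm k 5) (sym (m+n∸n≡m (5 * k) 1)))) (∸-monoˡ-≤ 1 ≤x)) ⟩
  (x ∸ 1) / 5       ∎
  where open ≤-Reasoning

theorem1p4 : (n : ℕ) → 2 ≤ n → (G : Graph n) → IsTree G →
    Σ ℕ λ k → IsGamma22 G k
    × ((n + 4 ∸ (numLeaves G + numSupport G)) + 4) / 5 ≤ k
    × k ≤ (n + 3 * numSupport G ∸ 1) / 5
theorem1p4 1 (s≤s ()) _ _
theorem1p4 2 _ G (conn , _) =
  let isγ , lower , upper = n≡2-bounds G conn
  in 1 , isγ , ceiling-bound {k = 1} lower , floor-bound {k = 1} upper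
theorem1p4 (suc (suc (suc n))) _ G tree =
  let k , isγ , lower , upper = n≥3-bounds G (s≤s (s≤s (s≤s z≤n))) tree zero
  in k , isγ , ceiling-bound {k = k} lower , floor-bound upper
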